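{- Let $R$ be an integral domain and let $A$ be an $n\times n$ matrix all of whose entries are non-zero elements of $R$. Suppose that for all integers $i,j$ with $1\le i<j\le n-1$, $$A_{i,j}A_{j,j+1}A_{j+1,i}=A_{j,i}A_{j+1,j}A_{i,j+1}.$$ Then for any positive integer $k$, any $k$ positive integers $m_1,m_2,\ldots,m_k$, and any sequence of integers $i_1,i_2,\ldots,i_k$ with $1\le i_t\le n$ for every $t$, we have $$(A^{m_1})_{i_1i_2}(A^{m_2})_{i_2i_3}\cdots (A^{m_k})_{i_ki_1} = (A^{m_1})_{i_2i_1}(A^{m_2})_{i_3i_2}\cdots (A^{m_k})_{i_1i_k}.$$ (That is, with $i_{k+1}:=i_1$, $\prod_{t=1}^k (A^{m_t})_{i_t i_{t+1}}=\prod_{t=1}^k (A^{m_t})_{i_{t+1} i_t}$.)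
   Context: $B_{ij}$ (also written $B_{i,j}$) denotes the $(i,j)$-th entry of a matrix $B$. -}

module Defs where

open import Algebra.Bundles using (CommutativeRing)
import Algebra.Definitions.RawMonoid as RawMonoidDefs
open import Data.Bool.Base using (if_then_else_)
open import Data.Fin.Base using (Fin; toℕ)
open import Data.Fin.Properties using (_≟_)
open import Data.Nat.Base using (ℕ; zero; suc; NonZero)
open import Data.Nat.DivMod using (_mod_)
open import Data.Vec.Functional using (Vector)
open import Level using (Level; _⊔_)
open import Relation.Nullary using (¬_; does)

-- "No zero divisors" is read as: x y = 0 and x ≠ 0 imply y = 0. This is
-- constructively implied by the form "x y = 0 implies x = 0 or y = 0", so
-- every ring satisfying the latter is covered.
record IsIntegralDomain {c ℓ : Level} (R : CommutativeRing c ℓ) : Set (c ⊔ ℓ) where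
  open CommutativeRing R
  field
    1≉0            : ¬ 1# ≈ 0#
    noZeroDivisors : ∀ x y → x * y ≈ 0# → ¬ x ≈ 0# → y ≈ 0#

-- The cyclic successor t ↦ t + 1 (mod k) on {0, …, k - 1}.
next : {k : ℕ} .{{_ : NonZero k}} → Fin k → Fin k
next {k} t = suc (toℕ t) mod k

module Matrices {c ℓ : Level} (R : CommutativeRing c ℓ) where
  open CommutativeRing R

  Matrix : ℕ → Set c
  Matrix n = Fin n → Fin n → Carrier

  ∑ : {n : ℕ} → Vector Carrier n → Carrier
  ∑ = RawMonoidDefs.sum +-rawMonoid

  -- The library's finite "sum", taken in the multiplicative monoid of R.
  ∏ : {n : ℕ} → Vector Carrier n → Carrier
  ∏ = RawMonoidDefs.sum *-rawMonoid

  identity : {n : ℕ} → Matrix n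
  identity i j = if does (i ≟ j) then 1# else 0#

  infixl 7 _·_
  _·_ : {n : ℕ} → Matrix n → Matrix n → Matrix n
  (A · B) i j = ∑ (λ l → A i l * B l j)

  infixr 8 _^_
  _^_ : {n : ℕ} → Matrix n → ℕ → Matrix n
  A ^ zero  = identity
  A ^ suc m = A · (A ^ m)

{-# OPTIONS --safe #-}

-- The hypothesis makes A symmetrizable: there are non-zero weights d with
-- d i * A i j = d j * A j i. The condition on adjacent indices forces
-- d (i + 1) / d i = A i (i + 1) / A (i + 1) i, and clearing denominators gives
--   d i = ∏_{t < i} A t (t + 1) * ∏_{t ≥ i} A (t + 1) t;
-- the triangle condition propagates the relation from (i , j) to (i , j + 1).
-- The weights also symmetrize every power of A, so multiplying either cyclic
-- product by ∏ d (i t) gives the same value, and the weights cancel.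
module Submission where

open import Defs
open import Algebra.Bundles using (CommutativeRing)
open import Data.Fin.Base using (Fin; toℕ) renaming (_<_ to _<ᶠ_)
open import Data.Nat.Base using (ℕ; suc; _<_; NonZero)
open import Level using (Level)
open import Relation.Binary.PropositionalEquality using (_≡_)
open import Relation.Nullary using (¬_)

open import Data.Fin.Base using (zero; suc; inject₁; fromℕ)
open import Data.Fin.Induction using (<-weakInduction)
open import Data.Fin.Properties
  using (toℕ-injective; toℕ-fromℕ; toℕ-fromℕ<; toℕ-inject₁; toℕ<n; <-cmp)
open import Data.Nat.Base using (zero; s≤s; s≤s⁻¹)
open import Data.Nat.DivMod using (m<n⇒m%n≡m; n%n≡0; _%_)
open import Data.Nat.Properties using (m≤n⇒m<n∨m≡n)
open import Data.Product.Base using (∃; _×_; _,_)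
open import Data.Sum.Base using (inj₁; inj₂)
open import Data.Vec.Functional using (Vector; head; tail)
open import Function.Base using (_∘_)
open import Relation.Binary.Definitions using (tri<; tri≈; tri>)
import Relation.Binary.PropositionalEquality as ≡

next-inject₁ : ∀ {k} (t : Fin k) → next (inject₁ t) ≡ suc t
next-inject₁ {k} t = toℕ-injective (≡.trans (toℕ-fromℕ< _) (≡.trans
  (≡.cong (λ a → suc a % suc k) (toℕ-inject₁ t))
  (m<n⇒m%n≡m (s≤s (toℕ<n t)))))

next-fromℕ : ∀ k → next (fromℕ k) ≡ zero
next-fromℕ k = toℕ-injective (≡.trans (toℕ-fromℕ< _) (≡.trans
  (≡.cong (λ a → suc a % suc k) (toℕ-fromℕ k))
  (n%n≡0 (suc k))))

module _ {c ℓ : Level} (R : CommutativeRing c ℓ) where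
  open CommutativeRing R hiding (zero)
  open Matrices R
  open import Relation.Binary.Reasoning.Setoid setoid
  open import Algebra.Properties.Semiring.Sum semiring
    using (*-distribˡ-sum; *-distribʳ-sum; ∑-comm; sum-cong-≋; sum-replicate-zero)
  open import Algebra.Properties.CommutativeMonoid.Sum *-commutativeMonoid
    using (sum-init-last)
    renaming (∑-distrib-+ to ∏-distrib-*; sum-cong-≋ to ∏-cong; sum-cong-≗ to ∏-cong-≡)
  open import Algebra.Solver.CommutativeMonoid *-commutativeMonoid
    using (solve; _⊕_; _⊜_)

  -- `next` raises every index but the last by one and sends the last to `zero`, so splitting off
  -- the last factor on the left leaves the tail of `f` times its head.
  ∏-next : ∀ {k} .{{_ : NonZero k}} (f : Vector Carrier k) → ∏ (f ∘ next) ≈ ∏ f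
  ∏-next {suc k} f = begin
    ∏ (f ∘ next)                                   ≈⟨ sum-init-last (f ∘ next) ⟩
    ∏ (f ∘ next ∘ inject₁) * f (next (fromℕ k))    ≡⟨ ≡.cong₂ _*_
                                                        (∏-cong-≡ (≡.cong f ∘ next-inject₁))
                                                        (≡.cong f (next-fromℕ k)) ⟩
    ∏ (f ∘ suc) * f zero                           ≈⟨ *-comm _ _ ⟩
    ∏ f                                            ∎

  infix 4 _≋_
  _≋_ : ∀ {n} → Matrix n → Matrix n → Set ℓ
  B ≋ C = ∀ i j → B i j ≈ C i j

  -- The recursion closes because `does (suc i ≟ suc j)` computes to `does (i ≟ j)`.
  identity-sym : ∀ {n} (i j : Fin n) → identity i j ≡ identity j i
  identity-sym zero    zero    = ≡.refl
  identity-sym zero    (suc j) = ≡.refl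
  identity-sym (suc i) zero    = ≡.refl
  identity-sym (suc i) (suc j) = identity-sym i j

  ∑-identity : ∀ {n} (i : Fin n) (f : Vector Carrier n) →
               ∑ (λ l → identity i l * f l) ≈ f i
  ∑-identity {suc n} zero f = begin
    1# * f zero + ∑ (λ l → 0# * f (suc l))  ≈⟨ +-cong (*-identityˡ _)
                                                 (trans (sum-cong-≋ (λ l → zeroˡ (f (suc l))))
                                                        (sum-replicate-zero n)) ⟩
    f zero + 0#                             ≈⟨ +-identityʳ _ ⟩
    f zero                                  ∎
  ∑-identity (suc i) f = begin
    0# * f zero + ∑ (λ l → identity i l * f (suc l))  ≈⟨ +-cong (zeroˡ _) (∑-identity i (f ∘ suc)) ⟩
    0# + f (suc i)                                    ≈⟨ +-identityˡ _ ⟩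
    f (suc i)                                         ∎

  ·-identityˡ : ∀ {n} (A : Matrix n) → identity · A ≋ A
  ·-identityˡ A i j = ∑-identity i (λ l → A l j)

  ·-identityʳ : ∀ {n} (A : Matrix n) → A · identity ≋ A
  ·-identityʳ A i j = trans
    (sum-cong-≋ (λ l → trans (*-comm _ _) (*-congʳ (reflexive (identity-sym l j)))))
    (∑-identity j (A i))

  ·-congˡ : ∀ {n} (A : Matrix n) {B C : Matrix n} → B ≋ C → A · B ≋ A · C
  ·-congˡ A B≋C i j = sum-cong-≋ (λ l → *-congˡ (B≋C l j))

  ·-assoc : ∀ {n} (A B C : Matrix n) → (A · B) · C ≋ A · (B · C)
  ·-assoc A B C i j = begin
    ∑ (λ l → ∑ (λ p → A i p * B p l) * C l j)    ≈⟨ sum-cong-≋ (λ l → *-distribʳ-sum (C l j) (λ p → A i p * B p l)) ⟩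
    ∑ (λ l → ∑ (λ p → A i p * B p l * C l j))    ≈⟨ ∑-comm (λ l p → A i p * B p l * C l j) ⟩
    ∑ (λ p → ∑ (λ l → A i p * B p l * C l j))    ≈⟨ sum-cong-≋ (λ p → sum-cong-≋ (λ l → *-assoc (A i p) (B p l) (C l j))) ⟩
    ∑ (λ p → ∑ (λ l → A i p * (B p l * C l j)))  ≈⟨ sum-cong-≋ (λ p → *-distribˡ-sum (A i p) (λ l → B p l * C l j)) ⟨
    ∑ (λ p → A i p * ∑ (λ l → B p l * C l j))    ∎

  -- Moving weights through a product reverses its factors; this restores the order in which `_^_`
  -- is defined.
  ^-comm : ∀ {n} (A : Matrix n) m → A · (A ^ m) ≋ (A ^ m) · A
  ^-comm A zero    i j = trans (·-identityʳ A i j) (sym (·-identityˡ A i j))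
  ^-comm A (suc m) i j = trans (·-congˡ A (^-comm A m) i j) (sym (·-assoc A (A ^ m) A i j))

  -- That is, the product of the diagonal matrix of `d` with `A` is symmetric.
  Symmetrizes : ∀ {n} → Vector Carrier n → Matrix n → Set ℓ
  Symmetrizes d A = ∀ i j → d i * A i j ≈ d j * A j i

  symmetrizes-identity : ∀ {n} (d : Vector Carrier n) → Symmetrizes d identity
  symmetrizes-identity d zero    zero    = refl
  symmetrizes-identity d zero    (suc j) = trans (zeroʳ _) (sym (zeroʳ _))
  symmetrizes-identity d (suc i) zero    = trans (zeroʳ _) (sym (zeroʳ _))
  symmetrizes-identity d (suc i) (suc j) = symmetrizes-identity (d ∘ suc) i j

  -- In each summand the weight passes from `i` to `l` across `A`, then from `l` to `j` across
  -- `A ^ m`. Both factors come out transposed, giving an entry of `(A ^ m) · A`.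
  symmetrizes-^ : ∀ {n} (d : Vector Carrier n) (A : Matrix n) →
                  Symmetrizes d A → ∀ m → Symmetrizes d (A ^ m)
  symmetrizes-^ d A dA zero    i j = symmetrizes-identity d i j
  symmetrizes-^ d A dA (suc m) i j = begin
    d i * ∑ (λ l → A i l * B l j)    ≈⟨ *-distribˡ-sum (d i) (λ l → A i l * B l j) ⟩
    ∑ (λ l → d i * (A i l * B l j))  ≈⟨ sum-cong-≋ moveWeight ⟩
    ∑ (λ l → d j * (B j l * A l i))  ≈⟨ *-distribˡ-sum (d j) (λ l → B j l * A l i) ⟨
    d j * ∑ (λ l → B j l * A l i)    ≈⟨ *-congˡ (^-comm A m j i) ⟨
    d j * ∑ (λ l → A j l * B l i)    ∎
    where
    B = A ^ m
    moveWeight : ∀ l → d i * (A i l * B l j) ≈ d j * (B j l * A l i)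
    moveWeight l = begin
      d i * (A i l * B l j)  ≈⟨ *-assoc _ _ _ ⟨
      d i * A i l * B l j    ≈⟨ *-congʳ (dA i l) ⟩
      d l * A l i * B l j    ≈⟨ solve 3 (λ x y z → (x ⊕ y) ⊕ z ⊜ (x ⊕ z) ⊕ y) refl (d l) (A l i) (B l j) ⟩
      d l * B l j * A l i    ≈⟨ *-congʳ (symmetrizes-^ d A dA m l j) ⟩
      d j * B j l * A l i    ≈⟨ *-assoc _ _ _ ⟩
      d j * (B j l * A l i)  ∎

  -- weights a b i = ∏_{t < i} a t * ∏_{t ≥ i} b t
  weights : ∀ {n} → Vector Carrier n → Vector Carrier n → Vector Carrier (suc n)
  weights         a b zero    = ∏ b
  weights {suc n} a b (suc i) = head a * weights (tail a) (tail b) i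

  -- Consecutive weights differ in a single factor: `b t` is replaced by `a t`.
  weights-step : ∀ {n} (a b : Vector Carrier n) t →
                 weights a b (inject₁ t) * a t ≈ weights a b (suc t) * b t
  weights-step a b zero    =
    solve 3 (λ x y z → (x ⊕ y) ⊕ z ⊜ (z ⊕ y) ⊕ x) refl (b zero) (∏ (tail b)) (a zero)
  weights-step a b (suc t) = begin
    a zero * w (inject₁ t) * a (suc t)    ≈⟨ *-assoc _ _ _ ⟩
    a zero * (w (inject₁ t) * a (suc t))  ≈⟨ *-congˡ (weights-step (tail a) (tail b) t) ⟩
    a zero * (w (suc t) * b (suc t))      ≈⟨ *-assoc _ _ _ ⟨
    a zero * w (suc t) * b (suc t)        ∎
    where w = weights (tail a) (tail b)

  module _ (R-domain : IsIntegralDomain R) where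
    open IsIntegralDomain R-domain
    open import Algebra.Properties.Ring ring using (x[y-z]≈xy-xz)
    open import Algebra.Properties.Group +-group
      using () renaming (x∙y⁻¹≈ε⇒x≈y to x-y≈0⇒x≈y; x≈y⇒x∙y⁻¹≈ε to x≈y⇒x-y≈0)

    *-≉0 : ∀ {x y} → ¬ x ≈ 0# → ¬ y ≈ 0# → ¬ x * y ≈ 0#
    *-≉0 x≉0 y≉0 xy≈0 = y≉0 (noZeroDivisors _ _ xy≈0 x≉0)

    *-cancelˡ-≉0 : ∀ z {x y} → ¬ z ≈ 0# → z * x ≈ z * y → x ≈ y
    *-cancelˡ-≉0 z {x} {y} z≉0 zx≈zy = x-y≈0⇒x≈y x y
      (noZeroDivisors z (x - y) (trans (x[y-z]≈xy-xz z x y) (x≈y⇒x-y≈0 zx≈zy)) z≉0)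

    ∏-≉0 : ∀ {n} (f : Vector Carrier n) → (∀ t → ¬ f t ≈ 0#) → ¬ ∏ f ≈ 0#
    ∏-≉0 {zero}  f f≉0 = 1≉0
    ∏-≉0 {suc n} f f≉0 = *-≉0 (f≉0 zero) (∏-≉0 (tail f) (f≉0 ∘ suc))

    weights-≉0 : ∀ {n} (a b : Vector Carrier n) → (∀ t → ¬ a t ≈ 0#) → (∀ t → ¬ b t ≈ 0#) →
                 ∀ i → ¬ weights a b i ≈ 0#
    weights-≉0         a b a≉0 b≉0 zero    = ∏-≉0 b b≉0
    weights-≉0 {suc n} a b a≉0 b≉0 (suc i) =
      *-≉0 (a≉0 zero) (weights-≉0 (tail a) (tail b) (a≉0 ∘ suc) (b≉0 ∘ suc) i)

    -- Taking the successor of `j` as a third element of `Fin n` encodes the bound that keeps it in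
    -- range.
    TriangleCondition : ∀ {n} → Matrix n → Set ℓ
    TriangleCondition {n} A = ∀ (i j j+1 : Fin n) → i <ᶠ j → toℕ j+1 ≡ suc (toℕ j) →
      A i j * A j j+1 * A j+1 i ≈ A j i * A j+1 j * A i j+1

    -- After multiplication by the non-zero `d j * A j i * (d k * A k j)`, the left side contains
    -- one orientation of the triangle. Reversing it and applying the two known relations yields the
    -- right side with the same multiplier, which cancels.
    triangle-step : ∀ {n} (A : Matrix n) (d : Vector Carrier n) →
      (∀ i j → ¬ A i j ≈ 0#) → (∀ i → ¬ d i ≈ 0#) → ∀ {i j k} →
      A i j * A j k * A k i ≈ A j i * A k j * A i k →
      d i * A i j ≈ d j * A j i → d j * A j k ≈ d k * A k j →
      d i * A i k ≈ d k * A k i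
    triangle-step A d A≉0 d≉0 {i} {j} {k} triangle dᵢⱼ dⱼₖ =
      *-cancelˡ-≉0 (d j * A j i * (d k * A k j))
        (*-≉0 (*-≉0 (d≉0 j) (A≉0 j i)) (*-≉0 (d≉0 k) (A≉0 k j)))
        (begin
          d j * A j i * (d k * A k j) * (d i * A i k)  ≈⟨ gather (d j) (A j i) (d k) (A k j) (d i) (A i k) ⟩
          d j * d k * d i * (A j i * A k j * A i k)    ≈⟨ *-congˡ triangle ⟨
          d j * d k * d i * (A i j * A j k * A k i)    ≈⟨ *-congʳ (solve 3 (λ x y z → (x ⊕ y) ⊕ z ⊜ (z ⊕ x) ⊕ y) refl (d j) (d k) (d i)) ⟩
          d i * d j * d k * (A i j * A j k * A k i)    ≈⟨ gather (d i) (A i j) (d j) (A j k) (d k) (A k i) ⟨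
          d i * A i j * (d j * A j k) * (d k * A k i)  ≈⟨ *-congʳ (*-cong dᵢⱼ dⱼₖ) ⟩
          d j * A j i * (d k * A k j) * (d k * A k i)  ∎)
      where
      gather = solve 6 (λ x a y b z c →
        ((x ⊕ a) ⊕ (y ⊕ b)) ⊕ (z ⊕ c) ⊜ ((x ⊕ y) ⊕ z) ⊕ ((a ⊕ b) ⊕ c)) refl

    symmetrizable : ∀ {n} (A : Matrix n) → (∀ i j → ¬ A i j ≈ 0#) → TriangleCondition A →
                    ∃ λ d → (∀ i → ¬ d i ≈ 0#) × Symmetrizes d A
    -- `weights` always has at least one entry, so the empty matrix is treated apart.
    symmetrizable {zero}  A A≉0 triangle = (λ ()) , (λ ()) , (λ ())
    symmetrizable {suc n} A A≉0 triangle = d , d≉0 , symmetrizes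
      where
      a b : Vector Carrier n
      a t = A (inject₁ t) (suc t)
      b t = A (suc t) (inject₁ t)
      d = weights a b
      d≉0 : ∀ i → ¬ d i ≈ 0#
      d≉0 = weights-≉0 a b (λ t → A≉0 _ _) (λ t → A≉0 _ _)

      UpTo : Fin (suc n) → Set ℓ
      UpTo j = ∀ i → i <ᶠ j → d i * A i j ≈ d j * A j i

      -- The entry next to the diagonal is `weights-step`; an earlier `i` is reached through the
      -- triangle on `i`, `inject₁ j` and `suc j`.
      upTo-suc : ∀ j → UpTo (inject₁ j) → UpTo (suc j)
      upTo-suc j upTo-j i i<1+j with m≤n⇒m<n∨m≡n (s≤s⁻¹ i<1+j)
      ... | inj₂ i≡j
        with ≡.refl ← toℕ-injective (≡.trans i≡j (≡.sym (toℕ-inject₁ j))) = weights-step a b j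
      ... | inj₁ i<j = triangle-step A d A≉0 d≉0
        (triangle i (inject₁ j) (suc j) i<j′ (≡.cong suc (≡.sym (toℕ-inject₁ j))))
        (upTo-j i i<j′) (weights-step a b j)
        where i<j′ = ≡.subst (toℕ i <_) (≡.sym (toℕ-inject₁ j)) i<j

      symmetrizes-< : ∀ j → UpTo j
      -- The base case is vacuous: no index lies below `zero`.
      symmetrizes-< = <-weakInduction UpTo (λ _ ()) upTo-suc

      symmetrizes : Symmetrizes d A
      symmetrizes i j with <-cmp i j
      ... | tri< i<j _ _    = symmetrizes-< j i i<j
      ... | tri≈ _ ≡.refl _ = refl
      ... | tri> _ _ j<i    = sym (symmetrizes-< i j j<i)

    -- Multiplying the relations over all `t` puts the same non-zero factor `∏ u` on both sides,
    -- since `next` only permutes the weights.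
    ∏-cyclic : ∀ {k} .{{_ : NonZero k}} (u x y : Vector Carrier k) → (∀ t → ¬ u t ≈ 0#) →
               (∀ t → u t * x t ≈ u (next t) * y t) → ∏ x ≈ ∏ y
    ∏-cyclic u x y u≉0 ux≈uy = *-cancelˡ-≉0 (∏ u) (∏-≉0 u u≉0) (begin
      ∏ u * ∏ x                     ≈⟨ ∏-distrib-* u x ⟨
      ∏ (λ t → u t * x t)           ≈⟨ ∏-cong ux≈uy ⟩
      ∏ (λ t → u (next t) * y t)    ≈⟨ ∏-distrib-* (u ∘ next) y ⟩
      ∏ (u ∘ next) * ∏ y            ≈⟨ *-congʳ (∏-next u) ⟩
      ∏ u * ∏ y                     ∎)

theorem1p3 :
    {c ℓ : Level} (R : CommutativeRing c ℓ) → IsIntegralDomain R →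
    let open CommutativeRing R
        open Matrices R
    in
    (n : ℕ) (A : Matrix n) →
    (∀ i j → ¬ A i j ≈ 0#) →
    (∀ (i j j+1 : Fin n) → i <ᶠ j → toℕ j+1 ≡ suc (toℕ j) →
      A i j * A j j+1 * A j+1 i ≈ A j i * A j+1 j * A i j+1) →
    (k : ℕ) .{{_ : NonZero k}} (m : Fin k → ℕ) → (∀ t → 0 < m t) →
    (i : Fin k → Fin n) →
    ∏ (λ t → (A ^ m t) (i t) (i (next t))) ≈ ∏ (λ t → (A ^ m t) (i (next t)) (i t))
theorem1p3 R R-domain n A A≉0 triangle k m m>0 i
  with d , d≉0 , dA ← symmetrizable R R-domain A A≉0 triangle =
  -- The weights are read along the closed walk `i`; each power may have its own exponent because
  -- `d` symmetrizes them all.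
  ∏-cyclic R R-domain (d ∘ i) _ _ (d≉0 ∘ i)
    (λ t → symmetrizes-^ R d A dA (m t) (i t) (i (next t)))
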